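{- Let $X$ be a connected cubic graph and let $G\leq\mathrm{Aut}\,X$ be an $s$-regular group of automorphisms with $s\in\{1,4\}$. Then every connected $G$-split $2$-cover of $X$ is the canonical double cover of $X$.
   Context: Graphs are finite and simple; maps are composed on the right. An $s$-arc is a sequence $(v_0,\dots,v_s)$ of vertices with $v_{i-1}\sim v_i$ and $v_{i-1}\neq v_{i+1}$; $G$ is $s$-regular if it acts regularly on the set of $s$-arcs. A regular covering projection $\wp\colon\tilde X\to X$ is a surjective graph homomorphism, locally bijective on neighbourhoods, whose group $\mathrm{CT}(\wp)$ of covering transformations (automorphisms $c$ of $\tilde X$ with $c\wp=\wp$) acts regularly on fibres; a $2$-cover has $\mathrm{CT}(\wp)\cong\mathbb{Z}_2$. A lift of $g\in\mathrm{Aut}\,X$ is $\tilde g\in\mathrm{Aut}\,\tilde X$ with $\wp g=\tilde g\wp$; $\wp$ is a $G$-split $2$-cover if every element of $G$ lifts and $\mathrm{CT}(\wp)$ has a complement in the lifted group $\tilde G$ (the group of all lifts). The canonical double cover of $X$ is the projection $(u,i)\mapsto u$ from the graph on $V(X)\times\mathbb{Z}_2$ with $(u,i)\sim(v,i+1)$ whenever $u\sim v$ (up to isomorphism of covering projections). -}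

module Defs where

open import Algebra.Bundles using (Group)
open import Algebra.Morphism.Structures using (IsGroupIsomorphism)
open import Data.Fin using (Fin; zero; suc; toℕ)
open import Data.Fin.Properties using (*↔×)
open import Data.List using (List; allFin; filter; length; map)
open import Data.Nat using (ℕ; _+_; _*_)
open import Data.Parity using (Parity; 0ℙ; 1ℙ)
  renaming (_+_ to _+ℙ_)
open import Data.Parity.Properties using ()
  renaming (+-0-group to ℤ₂; _≟_ to _≟ℙ_)
open import Data.Product using (Σ; ∃; ∃-syntax; ∃!; _×_; _,_; proj₁; proj₂)
open import Data.Product.Function.NonDependent.Propositional using (_×-↔_)
open import Data.Vec using (Vec; lookup)
import Data.Vec as Vec
open import Function.Bundles using (_↔_; _⇔_; Inverse; Equivalence; mk↔ₛ′; mk⇔)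
open import Function.Construct.Composition using (_↔-∘_; _⇔-∘_)
open import Function.Construct.Identity using (↔-id; ⇔-id)
open import Function.Construct.Symmetry using (↔-sym)
open import Function.Definitions using (Surjective)
open import Level using (Level; 0ℓ; _⊔_) renaming (suc to lsuc)
open import Relation.Binary.Construct.Closure.ReflexiveTransitive using (Star)
open import Relation.Binary.Core using (Rel)
open import Relation.Binary.Definitions using (Decidable; Irreflexive; Symmetric)
open import Relation.Binary.PropositionalEquality
  using (_≡_; _≢_; refl; sym; trans; cong; subst₂)
open import Relation.Nullary.Decidable using (_×-dec_)
open import Relation.Unary using (Pred; _∈_; _⊆_)

record Subgroup {c ℓ} (G : Group c ℓ) (p : Level) : Set (c ⊔ ℓ ⊔ lsuc p) where
  open Group G
  field
    Member    : Pred Carrier p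
    resp      : ∀ {x y} → x ≈ y → x ∈ Member → y ∈ Member
    ∙-closed  : ∀ {x y} → x ∈ Member → y ∈ Member → x ∙ y ∈ Member
    ε-closed  : ε ∈ Member
    ⁻¹-closed : ∀ {x} → x ∈ Member → x ⁻¹ ∈ Member

  group : Group (c ⊔ p) ℓ
  group = record
    { Carrier = Σ Carrier Member
    ; _≈_     = λ x y → proj₁ x ≈ proj₁ y
    ; _∙_     = λ (x , x∈) (y , y∈) → x ∙ y , ∙-closed x∈ y∈
    ; ε       = ε , ε-closed
    ; _⁻¹     = λ (x , x∈) → x ⁻¹ , ⁻¹-closed x∈
    ; isGroup = record
      { isMonoid = record
        { isSemigroup = record
          { isMagma = record
            { isEquivalence = record
              { refl  = Group.refl G
              ; sym   = Group.sym G
              ; trans = Group.trans G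
              }
            ; ∙-cong = ∙-cong
            }
          ; assoc = λ x y z → assoc (proj₁ x) (proj₁ y) (proj₁ z)
          }
        ; identity = (λ x → identityˡ (proj₁ x)) , (λ x → identityʳ (proj₁ x))
        }
      ; inverse = (λ x → inverseˡ (proj₁ x)) , (λ x → inverseʳ (proj₁ x))
      ; ⁻¹-cong = ⁻¹-cong
      }
    }

open Subgroup public using (Member)

record IsComplement {c ℓ p} {G : Group c ℓ} (N H K : Subgroup G p) : Set (c ⊔ ℓ ⊔ p) where
  open Group G
  field
    K⊆H     : Member K ⊆ Member H
    trivial : ∀ {x} → x ∈ Member N → x ∈ Member K → x ≈ ε
    factor  : ∀ {h} → h ∈ Member H →
              ∃[ n ] ∃[ k ] n ∈ Member N × k ∈ Member K × h ≈ n ∙ k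

_≅ᴳ_ : ∀ {a b c d} → Group a b → Group c d → Set (a ⊔ b ⊔ c ⊔ d)
G ≅ᴳ H = ∃ (IsGroupIsomorphism (Group.rawGroup G) (Group.rawGroup H))

record Graph : Set₁ where
  infix 4 _∼_ _∼?_
  field
    V        : Set
    order    : ℕ
    enum     : V ↔ Fin order
    _∼_      : Rel V 0ℓ
    _∼?_     : Decidable _∼_
    ∼-sym    : Symmetric _∼_
    ∼-irrefl : Irreflexive _≡_ _∼_

  vertices : List V
  vertices = map (Inverse.from enum) (allFin order)

  degree : V → ℕ
  degree u = length (filter (u ∼?_) vertices)

  Cubic : Set
  Cubic = ∀ u → degree u ≡ 3

  -- The factor V says that a connected graph is nonempty.
  Connected : Set
  Connected = V × (∀ u v → Star _∼_ u v)

  record IsArc (s : ℕ) (a : Vec V (1 + s)) : Set where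
    field
      adjacent        : ∀ i j → toℕ j ≡ 1 + toℕ i → lookup a i ∼ lookup a j
      nonbacktracking : ∀ i j → toℕ j ≡ 2 + toℕ i → lookup a i ≢ lookup a j

open Graph public using (V; Cubic; Connected; IsArc)

record _≅_ (X Y : Graph) : Set where
  private
    module X = Graph X
    module Y = Graph Y
  field
    bijection : X.V ↔ Y.V
  open Inverse bijection public using (to; from; strictlyInverseˡ; strictlyInverseʳ)
  field
    adjacency : ∀ {u v} → u X.∼ v ⇔ to u Y.∼ to v

open _≅_ public using (bijection; adjacency)

Automorphism : Graph → Set
Automorphism X = X ≅ X

-- Automorphisms act on the right.
infixl 8 _·_
_·_ : ∀ {X} → V X → Automorphism X → V X
v · g = _≅_.to g v

-- The product g ∙ h is "first g, then h".
Aut : Graph → Group 0ℓ 0ℓ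
Aut X = record
  { Carrier = Automorphism X
  ; _≈_     = λ g h → ∀ v → v · g ≡ v · h
  ; _∙_     = λ g h → record
    { bijection = bijection h ↔-∘ bijection g
    ; adjacency = adjacency h ⇔-∘ adjacency g
    }
  ; ε       = record { bijection = ↔-id _ ; adjacency = ⇔-id _ }
  ; _⁻¹     = inv
  ; isGroup = record
    { isMonoid = record
      { isSemigroup = record
        { isMagma = record
          { isEquivalence = record
            { refl  = λ _ → refl
            ; sym   = λ p v → sym (p v)
            ; trans = λ p q v → trans (p v) (q v)
            }
          ; ∙-cong = λ {_} {_} {h} p q v → trans (cong (_· h) (p v)) (q _)
          }
        ; assoc = λ _ _ _ _ → refl
        }
      ; identity = (λ _ _ → refl) , (λ _ _ → refl)
      }
    ; inverse = (λ g → _≅_.strictlyInverseˡ g) , (λ g → _≅_.strictlyInverseʳ g)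
    ; ⁻¹-cong = λ {g} {h} p v →
        trans (sym (_≅_.strictlyInverseʳ h _))
          (cong (_≅_.from h)
            (trans (sym (p _)) (_≅_.strictlyInverseˡ g v)))
    }
  }
  where
  open Graph X using (_∼_)

  inv : Automorphism X → Automorphism X
  inv g = record
    { bijection = ↔-sym (bijection g)
    ; adjacency = mk⇔
        (λ u∼v → Equivalence.from (adjacency g)
          (subst₂ _∼_ (sym (_≅_.strictlyInverseˡ g _)) (sym (_≅_.strictlyInverseˡ g _)) u∼v))
        (λ u∼v → subst₂ _∼_ (_≅_.strictlyInverseˡ g _) (_≅_.strictlyInverseˡ g _)
          (Equivalence.to (adjacency g) u∼v))
    }

-- For every a, b in S exactly one h in H sends a to b.  S is meant to be
-- invariant under H; uniqueness of h is up to pointwise equality of maps.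
ActsRegularlyOn : ∀ {X} {A : Set} → Subgroup (Aut X) 0ℓ →
                  (A → Automorphism X → A) → Pred A 0ℓ → Set
ActsRegularlyOn {X} H _◁_ S =
  ∀ {a b} → a ∈ S → b ∈ S →
  ∃! (Group._≈_ (Aut X)) (λ h → h ∈ Member H × (a ◁ h) ≡ b)

ArcRegular : ∀ {X} → ℕ → Subgroup (Aut X) 0ℓ → Set
ArcRegular {X} s G = ActsRegularlyOn G (λ a g → Vec.map (_· g) a) (IsArc X s)

module _ {X̃ X : Graph} (℘ : V X̃ → V X) where
  private
    module X̃ = Graph X̃
    module X = Graph X
    module Aut-X = Group (Aut X)
    module Aut-X̃ = Group (Aut X̃)

  CT : Subgroup (Aut X̃) 0ℓ
  CT = record
    { Member    = λ c → ∀ x → ℘ (x · c) ≡ ℘ x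
    ; resp      = λ p c∈ x → trans (cong ℘ (sym (p x))) (c∈ x)
    ; ∙-closed  = λ c∈ d∈ x → trans (d∈ _) (c∈ x)
    ; ε-closed  = λ _ → refl
    ; ⁻¹-closed = λ {c} c∈ x →
        trans (sym (c∈ _)) (cong ℘ (Aut-X̃.inverseˡ c x))
    }

  record IsRegularCovering : Set where
    field
      homomorphism     : ∀ {x y} → x X̃.∼ y → ℘ x X.∼ ℘ y
      surjective       : Surjective _≡_ _≡_ ℘
      locallyBijective : ∀ x {v} → ℘ x X.∼ v → ∃! _≡_ (λ y → x X̃.∼ y × ℘ y ≡ v)
      fibreRegular     : ∀ v → ActsRegularlyOn CT _·_ (λ x → ℘ x ≡ v)

  IsLift : Automorphism X → Automorphism X̃ → Set
  IsLift g g̃ = ∀ x → ℘ x · g ≡ ℘ (x · g̃)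

  Lifted : Subgroup (Aut X) 0ℓ → Subgroup (Aut X̃) 0ℓ
  Lifted G = record
    { Member    = λ g̃ → ∃[ g ] g ∈ Member G × IsLift g g̃
    ; resp      = λ p (g , g∈ , l) → g , g∈ , λ x → trans (l x) (cong ℘ (p x))
    ; ∙-closed  = λ (g , g∈ , l) (h , h∈ , m) →
        g Aut-X.∙ h , Subgroup.∙-closed G g∈ h∈ ,
        λ x → trans (cong (_· h) (l x)) (m _)
    ; ε-closed  = Aut-X.ε , Subgroup.ε-closed G , λ _ → refl
    ; ⁻¹-closed = λ {g̃} (g , g∈ , l) →
        g Aut-X.⁻¹ , Subgroup.⁻¹-closed G g∈ , λ x →
          trans (cong (_· (g Aut-X.⁻¹))
                  (trans (cong ℘ (sym (Aut-X̃.inverseˡ g̃ x))) (sym (l _))))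
                (Aut-X.inverseʳ g _)
    }

  record IsSplit2Cover (G : Subgroup (Aut X) 0ℓ) : Set₁ where
    field
      isRegularCovering : IsRegularCovering
      CT≅ℤ₂             : Subgroup.group CT ≅ᴳ ℤ₂
      lifts             : ∀ g → g ∈ Member G → ∃ (IsLift g)
      split             : ∃ (IsComplement CT (Lifted G))

-- Isomorphism over the identity of X.  Allowing an automorphism of X on the
-- base would not change which coverings are isomorphic to the canonical double
-- cover, since every automorphism of X lifts along it.
CoveringIso : ∀ {X Ỹ Z̃} → (V Ỹ → V X) → (V Z̃ → V X) → Set
CoveringIso {X} {Ỹ} {Z̃} ℘ ℘′ = ∃ λ (φ : Ỹ ≅ Z̃) → ∀ y → ℘′ (_≅_.to φ y) ≡ ℘ y

Parity↔Fin2 : Parity ↔ Fin 2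
Parity↔Fin2 = mk↔ₛ′
  (λ { 0ℙ → zero ; 1ℙ → suc zero })
  (λ { zero → 0ℙ ; (suc zero) → 1ℙ })
  (λ { zero → refl ; (suc zero) → refl })
  (λ { 0ℙ → refl ; 1ℙ → refl })

CDC : Graph → Graph
CDC X = record
  { V        = X.V × Parity
  ; order    = X.order * 2
  ; enum     = ↔-sym *↔× ↔-∘ (X.enum ×-↔ Parity↔Fin2)
  ; _∼_      = λ (u , i) (v , j) → u X.∼ v × j ≡ i +ℙ 1ℙ
  ; _∼?_     = λ (u , i) (v , j) → (u X.∼? v) ×-dec (j ≟ℙ i +ℙ 1ℙ)
  ; ∼-sym    = λ { {_ , i} (u∼v , refl) → X.∼-sym u∼v , flip-flip i }
  ; ∼-irrefl = λ { refl (u∼u , _) → X.∼-irrefl refl u∼u }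
  }
  where
  module X = Graph X

  flip-flip : ∀ i → i ≡ (i +ℙ 1ℙ) +ℙ 1ℙ
  flip-flip 0ℙ = refl
  flip-flip 1ℙ = refl

CDC-projection : ∀ X → V (CDC X) → V X
CDC-projection X = proj₁

{-# OPTIONS --safe #-}
module Submission where

-- A complement K of CT(℘) acts on X as G.  Suppose first that in K the stabilizer of
-- each fibre fixes it pointwise.  Then the K-orbits are two sections of ℘, interchanged
-- by CT(℘); by arc-transitivity either all edges run within the orbits, and X̃ is
-- disconnected, or all run between them, and X̃ is the canonical double cover.
--
-- It remains to see that k ∈ K with v k = v fixes the fibre over v.  Squares in K_v fix
-- it, since it has two points.  If k fixes all neighbours of v this holds because, for
-- s = 1, k = 1, and for s = 4, k is a square: among the three neighbours of v two are
-- treated alike by k, that is, k fixes the spheres around both, and then k = 1, or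
-- moves both, and then k = h² for an h interchanging them.  Hence it also holds if k
-- acts as a 3-cycle on the neighbours, k³ being of the former kind.  For s = 1 nothing
-- acts as a transposition.  If s = 4 and k acts as one and moves x over v, then K_x acts
-- on the neighbours by even permutations, and likewise at every vertex of X̃.  So an
-- element of K_x fixing all neighbours of x fixes, by connectivity, all of X̃; but there
-- are nontrivial such elements.

open import Defs
open import Algebra.Bundles using (Group)
open import Algebra.Morphism.Structures using (module GroupMorphisms)
open import Data.Fin using (Fin; zero; suc)
open import Data.Fin.Properties using (all?; any?) renaming (_≟_ to _≟ᶠ_)
open import Data.List using (List; filter) renaming (lookup to lookupᴸ)
open import Data.List.Membership.Propositional.Properties
  using (∈-lookup; ∈-allFin; ∈-map⁺; ∈-filter⁺; ∈-filter⁻)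
import Data.List.Relation.Unary.All as All
open import Data.List.Relation.Unary.AllPairs using (_∷_)
import Data.List.Relation.Unary.Any as Any
open import Data.List.Relation.Unary.Any.Properties using (lookup-index)
open import Data.List.Relation.Unary.Unique.Propositional using (Unique)
import Data.List.Relation.Unary.Unique.Propositional.Properties as Uniqueₚ
open import Data.Nat using (ℕ; _+_)
open import Data.Nat.Properties using (suc-injective)
open import Data.Parity using (Parity; 0ℙ; 1ℙ) renaming (_+_ to _+ℙ_)
open import Data.Product using (∃; ∃-syntax; _×_; _,_; proj₁; proj₂)
open import Data.Sum using (_⊎_; inj₁; inj₂) renaming (map to map-⊎)
open import Data.Vec using (Vec; []; _∷_; lookup) renaming (map to mapⱽ)
open import Data.Vec.Properties
  using (lookup∘tabulate; ∷-injectiveˡ; ∷-injectiveʳ; map-cong; lookup-map)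
open import Function using (_∘_)
open import Function.Bundles using (Injection; Inverse; Equivalence; mk↔ₛ′; mk⇔)
open import Function.Construct.Symmetry using (↔-sym)
open import Function.Properties.Inverse using (↔⇒↣)
open import Level using (0ℓ)
open import Relation.Binary.Construct.Closure.ReflexiveTransitive using (Star; _◅_) renaming (ε to ε⋆)
open import Relation.Binary.Definitions using (DecidableEquality)
open import Relation.Binary.PropositionalEquality
  using (_≡_; _≢_; refl; sym; trans; cong; cong₂; subst; subst₂; ≢-sym)
open import Relation.Nullary using (¬_; Dec; yes; no; contradiction)
open import Relation.Nullary.Decidable
  using (toWitness; _×-dec_; _⊎-dec_; _→-dec_; ¬?; via-injection; decidable-stable)

-- Lists without repetition, and permutations of three points.

lookup-injective : ∀ {A : Set} {xs : List A} → Unique xs →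
                   ∀ i j → lookupᴸ xs i ≡ lookupᴸ xs j → i ≡ j
lookup-injective (_ ∷ _)  zero    zero    _  = refl
lookup-injective (x≢ ∷ _) zero    (suc j) eq = contradiction eq (All.lookup x≢ (∈-lookup j))
lookup-injective (x≢ ∷ _) (suc i) zero    eq = contradiction (sym eq) (All.lookup x≢ (∈-lookup i))
lookup-injective (_ ∷ u)  (suc i) (suc j) eq = cong suc (lookup-injective u i j eq)

-- On three points the even permutations are the identity and the 3-cycles, so evenness can be
-- expressed by fixed points alone.
FixesAllOrNone : ∀ {A : Set} → (A → Set) → (A → A) → Set
FixesAllOrNone P f = (∀ {x} → P x → f x ≡ x) ⊎ (∀ {x} → P x → f x ≢ x)

module Fin3 where

  Even : (Fin 3 → Fin 3) → Set
  Even f = (∀ i → f i ≡ i) ⊎ (∀ i → f i ≢ i)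

  even? : ∀ f → Dec (Even f)
  even? f = all? (λ i → f i ≟ᶠ i) ⊎-dec all? (λ i → ¬? (f i ≟ᶠ i))

  Inj : (Fin 3 → Fin 3) → Set
  Inj f = ∀ i j → f i ≡ f j → i ≡ j

  inj? : ∀ f → Dec (Inj f)
  inj? f = all? λ i → all? λ j → (f i ≟ᶠ f j) →-dec (i ≟ᶠ j)

  -- Writing a function as its three values turns quantification over functions into a finite search
  -- that `all?` can decide.
  table : Fin 3 → Fin 3 → Fin 3 → Fin 3 → Fin 3
  table a b c = lookup (a ∷ b ∷ c ∷ [])

  toTable : (f : Fin 3 → Fin 3) → ∀ i →
            table (f zero) (f (suc zero)) (f (suc (suc zero))) i ≡ f i
  toTable f = lookup∘tabulate f

  even-resp : ∀ {f g} → (∀ i → f i ≡ g i) → Even f → Even g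
  even-resp f≗g = map-⊎ (λ e i → trans (sym (f≗g i)) (e i)) (λ e i p → e i (trans (f≗g i) p))

  inj-resp : ∀ {f g} → (∀ i → f i ≡ g i) → Inj f → Inj g
  inj-resp f≗g inj i j eq = inj i j (trans (f≗g i) (trans eq (sym (f≗g j))))

  -- The sign is multiplicative, so `f`, `g` and `g ∘ f` cannot all be odd.
  one-even : ∀ f g → Inj f → Inj g → Even f ⊎ Even g ⊎ Even (g ∘ f)
  one-even f g f-inj g-inj =
    map-⊎ (even-resp (toTable f)) (map-⊎ (even-resp (toTable g)) (even-resp composite))
      (onTables _ _ _ _ _ _ (inj-resp (sym ∘ toTable f) f-inj) (inj-resp (sym ∘ toTable g) g-inj))
    where
    onTables : ∀ a b c a′ b′ c′ → Inj (table a b c) → Inj (table a′ b′ c′) →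
      Even (table a b c) ⊎ Even (table a′ b′ c′) ⊎ Even (table a′ b′ c′ ∘ table a b c)
    onTables = toWitness {a? = all? λ a → all? λ b → all? λ c → all? λ a′ → all? λ b′ → all? λ c′ →
      inj? (table a b c) →-dec (inj? (table a′ b′ c′) →-dec
      (even? (table a b c) ⊎-dec (even? (table a′ b′ c′) ⊎-dec
       even? (table a′ b′ c′ ∘ table a b c))))} _

    composite : ∀ i → _ ≡ g (f i)
    composite i = trans (cong (table _ _ _) (toTable f i)) (toTable g (f i))

  -- A permutation of three points without fixed points is a 3-cycle.
  cube-id : ∀ f → Inj f → (∀ i → f i ≢ i) → ∀ i → f (f (f i)) ≡ i
  cube-id f f-inj free i =
    trans (sym (trans (cong f′ (trans (cong f′ (toTable f i)) (toTable f (f i)))) (toTable f _)))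
      (onTables _ _ _ (inj-resp (sym ∘ toTable f) f-inj)
        (λ j p → free j (trans (sym (toTable f j)) p)) i)
    where
    f′ = table (f zero) (f (suc zero)) (f (suc (suc zero)))
    onTables : ∀ a b c → let t = table a b c in Inj t → (∀ i → t i ≢ i) → ∀ i → t (t (t i)) ≡ i
    onTables = toWitness {a? = all? λ a → all? λ b → all? λ c → let t = table a b c in
      inj? t →-dec (all? (λ i → ¬? (t i ≟ᶠ i)) →-dec all? (λ i → t (t (t i)) ≟ᶠ i))} _

  others : ∀ (i : Fin 3) → ∃[ j ] ∃[ k ] (i ≢ j × i ≢ k × j ≢ k × (∀ l → l ≢ i → l ≢ j → l ≡ k))
  others = toWitness {a? = all? λ i → any? λ j → any? λ k →
    ¬? (i ≟ᶠ j) ×-dec (¬? (i ≟ᶠ k) ×-dec (¬? (j ≟ᶠ k) ×-dec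
    all? λ l → ¬? (l ≟ᶠ i) →-dec (¬? (l ≟ᶠ j) →-dec (l ≟ᶠ k))))} _

-- Neighbourhoods and arcs in a cubic graph.

module Vertices (X : Graph) where
  open Graph X using (enum)

  infix 4 _≟_
  _≟_ : DecidableEquality (V X)
  _≟_ = via-injection (↔⇒↣ enum) _≟ᶠ_

record Enumeration (n : ℕ) {A : Set} (P : A → Set) : Set where
  field
    at       : Fin n → A
    holds    : ∀ i → P (at i)
    distinct : ∀ i j → at i ≡ at j → i ≡ j
    index    : ∀ {x} → P x → Fin n
    at-index : ∀ {x} (p : P x) → at (index p) ≡ x

module CubicGraph (X : Graph) (cubic : Cubic X) where
  open Graph X using (enum; order; _∼_; _∼?_; ∼-sym; vertices; degree)
  open Vertices X

  -- The degree is the length of a filtered list without repetitions, so positions in that list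
  -- label the neighbours by `Fin 3`.
  neighbourhood : ∀ u → Enumeration 3 (u ∼_)
  neighbourhood u = subst (λ n → Enumeration n (u ∼_)) (cubic u) byDegree
    where
    N = filter (u ∼?_) vertices

    vertices! : Unique vertices
    vertices! = Uniqueₚ.map⁺ (Injection.injective (↔⇒↣ (↔-sym enum))) (Uniqueₚ.allFin⁺ order)

    ∈-N : ∀ {w} → u ∼ w → _
    ∈-N {w} u∼w = ∈-filter⁺ (u ∼?_) {xs = vertices}
      (subst (λ z → Any.Any (z ≡_) vertices) (Inverse.strictlyInverseʳ enum w)
        (∈-map⁺ (Inverse.from enum) (∈-allFin (Inverse.to enum w)))) u∼w

    byDegree : Enumeration (degree u) (u ∼_)
    byDegree = record
      { at       = lookupᴸ N
      ; holds    = λ i → proj₂ (∈-filter⁻ (u ∼?_) {xs = vertices} (∈-lookup i))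
      ; distinct = lookup-injective (Uniqueₚ.filter⁺ (u ∼?_) vertices!)
      ; index    = λ u∼w → Any.index (∈-N u∼w)
      ; at-index = λ u∼w → sym (lookup-index (∈-N u∼w))
      }

  module N u = Enumeration (neighbourhood u)

  record OtherNeighbours (u p : V X) : Set where
    field
      q r : V X
      u∼q : u ∼ q
      u∼r : u ∼ r
      p≢q : p ≢ q
      p≢r : p ≢ r
      q≢r : q ≢ r
      rest : ∀ {w} → u ∼ w → w ≢ p → w ≢ q → w ≡ r

  others : ∀ {u p} → u ∼ p → OtherNeighbours u p
  others {u} {p} u∼p with N.index u u∼p | N.at-index u u∼p
  ... | i | refl with Fin3.others i
  ... | j , k , i≢j , i≢k , j≢k , only = record
    { q = N.at u j ; r = N.at u k
    ; u∼q = N.holds u j ; u∼r = N.holds u k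
    ; p≢q = i≢j ∘ N.distinct u i j
    ; p≢r = i≢k ∘ N.distinct u i k
    ; q≢r = j≢k ∘ N.distinct u j k
    ; rest = λ u∼w w≢p w≢q → trans (sym (N.at-index u u∼w)) (cong (N.at u)
        (only (N.index u u∼w)
          (λ e → w≢p (trans (sym (N.at-index u u∼w)) (cong (N.at u) e)))
          (λ e → w≢q (trans (sym (N.at-index u u∼w)) (cong (N.at u) e)))))
    }

  record Embedding (f : V X → V X) : Set where
    field
      adj : ∀ {u w} → u ∼ w → f u ∼ f w
      inj : ∀ {u w} → f u ≡ f w → u ≡ w

  open OtherNeighbours
  open Embedding

  -- By injectivity the image of the third neighbour avoids the images of the other two, which
  -- leaves one possibility.
  r-image : ∀ {f u p u′ p′} → Embedding f → (O : OtherNeighbours u p)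
            (O′ : OtherNeighbours u′ p′) →
            f u ≡ u′ → f p ≡ p′ → f (q O) ≡ q O′ → f (r O) ≡ r O′
  r-image F O O′ refl refl fq = rest O′ (adj F (u∼r O))
    (λ e → p≢r O (sym (inj F e)))
    (λ e → q≢r O (sym (inj F (trans e (sym fq)))))

  q-moves : ∀ {f u p} → Embedding f → (O : OtherNeighbours u p) →
            f u ≡ u → f p ≡ p → f (q O) ≢ q O → f (q O) ≡ r O
  q-moves {f} F O fu fp fq = rest O (subst (_∼ _) fu (adj F (u∼q O)))
    (λ e → p≢q O (sym (inj F (trans e (sym fp))))) fq

  module Local {f} (F : Embedding f) {v} (fv : f v ≡ v) where

    adj-at : ∀ {w} → v ∼ w → v ∼ f w
    adj-at v∼w = subst (_∼ _) fv (adj F v∼w)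

    perm : Fin 3 → Fin 3
    perm i = N.index v (adj-at (N.holds v i))

    at-perm : ∀ i → N.at v (perm i) ≡ f (N.at v i)
    at-perm i = N.at-index v (adj-at (N.holds v i))

    perm-inj : Fin3.Inj perm
    perm-inj i j e = N.distinct v i j
      (inj F (trans (sym (at-perm i)) (trans (cong (N.at v) e) (at-perm j))))

  fromPerm : ∀ {v} {f : V X → V X} (π : Fin 3 → Fin 3) → (∀ i → N.at v (π i) ≡ f (N.at v i)) →
             Fin3.Even π → FixesAllOrNone (v ∼_) f
  fromPerm {v} {f} π π-f (inj₁ all)  = inj₁ λ v∼w → subst (λ z → f z ≡ z) (N.at-index v v∼w)
    (trans (sym (π-f _)) (cong (N.at v) (all _)))
  fromPerm {v} {f} π π-f (inj₂ none) = inj₂ λ v∼w → subst (λ z → f z ≢ z) (N.at-index v v∼w)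
    (λ e → none _ (N.distinct v _ _ (trans (π-f _) e)))

  one-locally-even : ∀ {f g v} → Embedding f → Embedding g → f v ≡ v → g v ≡ v →
    FixesAllOrNone (v ∼_) f ⊎ FixesAllOrNone (v ∼_) g ⊎ FixesAllOrNone (v ∼_) (g ∘ f)
  one-locally-even {f} {g} {v} F G fv gv =
    map-⊎ (fromPerm LF.perm LF.at-perm)
      (map-⊎ (fromPerm LG.perm LG.at-perm)
        (fromPerm (LG.perm ∘ LF.perm) (λ i → trans (LG.at-perm _) (cong g (LF.at-perm i)))))
      (Fin3.one-even LF.perm LG.perm LF.perm-inj LG.perm-inj)
    where
    module LF = Local F fv
    module LG = Local G gv

  free-cube : ∀ {f v} → Embedding f → f v ≡ v → (∀ {w} → v ∼ w → f w ≢ w) →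
              ∀ {w} → v ∼ w → f (f (f w)) ≡ w
  free-cube {f} {v} F fv free v∼w = subst (λ z → f (f (f z)) ≡ z) (N.at-index v v∼w)
    (trans (cong (f ∘ f) (sym (at-perm _))) (trans (cong f (sym (at-perm _)))
      (trans (sym (at-perm _)) (cong (N.at v) (Fin3.cube-id perm perm-inj
        (λ i e → free (N.holds v i) (trans (sym (at-perm i)) (cong (N.at v) e))) _)))))
    where open Local F fv

  arc₁ : ∀ {u v} → u ∼ v → IsArc X 1 (u ∷ v ∷ [])
  arc₁ u∼v = record
    { adjacent        = λ { zero (suc zero) refl → u∼v }
    ; nonbacktracking = λ { zero (suc zero) () ; (suc zero) (suc zero) () }
    }

  extendArc : ∀ {s u v w} {a : Vec (V X) s} → u ∼ v → u ≢ w →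
              IsArc X (1 + s) (v ∷ w ∷ a) → IsArc X (2 + s) (u ∷ v ∷ w ∷ a)
  extendArc u∼v u≢w arc = record
    { adjacent        = λ { zero (suc zero) refl → u∼v
                          ; (suc i) (suc j) e → IsArc.adjacent arc i j (suc-injective e) }
    ; nonbacktracking = λ { zero (suc (suc zero)) refl → u≢w
                          ; (suc i) (suc j) e → IsArc.nonbacktracking arc i j (suc-injective e) }
    }

  arc₄ : ∀ {t u v w x} → t ∼ u → u ∼ v → v ∼ w → w ∼ x → t ≢ v → u ≢ w → v ≢ x →
         IsArc X 4 (t ∷ u ∷ v ∷ w ∷ x ∷ [])
  arc₄ tu uv vw wx tv uw vx = extendArc tu tv (extendArc uv uw (extendArc vw vx (arc₁ wx)))

  flip : ∀ {u p} → OtherNeighbours u p → OtherNeighbours u p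
  flip O = record
    { q = r O ; r = q O ; u∼q = u∼r O ; u∼r = u∼q O
    ; p≢q = p≢r O ; p≢r = p≢q O ; q≢r = ≢-sym (q≢r O)
    ; rest = λ {w} u∼w w≢p w≢r → decidable-stable (w ≟ q O) (λ w≢q → w≢r (rest O u∼w w≢p w≢q))
    }

  -- Serves to deduce transitivity on 1-arcs from transitivity on 4-arcs.
  longArc : ∀ {u v} → u ∼ v → ∃ λ w → ∃ λ x → ∃ λ y → IsArc X 4 (u ∷ v ∷ w ∷ x ∷ y ∷ [])
  longArc {u} {v} u∼v = q O , q O′ , q O″ ,
      arc₄ u∼v (u∼q O) (u∼q O′) (u∼q O″) (p≢q O) (p≢q O′) (p≢q O″)
    where
    O : OtherNeighbours v u
    O  = others (∼-sym u∼v)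
    O′ : OtherNeighbours (q O) v
    O′ = others (∼-sym (u∼q O))
    O″ : OtherNeighbours (q O′) (q O)
    O″ = others (∼-sym (u∼q O′))

  -- With `v` in the middle, an automorphism fixing or reversing the inner 2-arc lies in the
  -- stabilizer of `v`.
  centredArc : ∀ {b v c} → v ∼ b → v ∼ c → b ≢ c → (B : OtherNeighbours b v) (C : OtherNeighbours c v) →
               IsArc X 4 (q B ∷ b ∷ v ∷ c ∷ q C ∷ [])
  centredArc v∼b v∼c b≢c B C =
    arc₄ (∼-sym (u∼q B)) (∼-sym v∼b) v∼c (u∼q C) (≢-sym (p≢q B)) b≢c (p≢q C)

-- Two-point fibres and the action of the complement.

module SplitCover
  {X X̃ : Graph} (cubic : Cubic X) (X̃-connected : Connected X̃)
  {℘ : V X̃ → V X} {G : Subgroup (Aut X) 0ℓ}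
  (cover : IsSplit2Cover {X̃} {X} ℘ G)
  where

  private
    module X̃ = Graph X̃
    module Aut-X̃ = Group (Aut X̃)
  open Graph X using (_∼_; ∼-sym)
  open IsSplit2Cover cover
  open IsRegularCovering isRegularCovering public

  open Vertices X
  open Vertices X̃ using () renaming (_≟_ to _≟̃_)
  open CubicGraph X cubic
  open OtherNeighbours

  lift-unique : ∀ {x y z} → x X̃.∼ y → x X̃.∼ z → ℘ y ≡ ℘ z → y ≡ z
  lift-unique {x} x∼y x∼z e with locallyBijective x (homomorphism x∼y)
  ... | _ , _ , unique = trans (sym (unique (x∼y , refl))) (unique (x∼z , sym e))

  section : V X → V X̃
  section v = proj₁ (surjective v)

  ℘-section : ∀ v → ℘ (section v) ≡ v
  ℘-section v = proj₂ (surjective v) refl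

  private
    module CTG = Group (Subgroup.group (CT {X̃} {X} ℘))
    module Iso = GroupMorphisms.IsGroupIsomorphism (proj₂ CT≅ℤ₂)
    module Hom = GroupMorphisms.IsGroupHomomorphism Iso.isGroupHomomorphism
    sgn = proj₁ CT≅ℤ₂

    swap : CTG.Carrier
    swap = proj₁ (Iso.surjective 1ℙ)

    sgn-swap : sgn swap ≡ 1ℙ
    sgn-swap = proj₂ (Iso.surjective 1ℙ) {swap} (λ _ → refl)

  τ : V X̃ → V X̃
  τ x = x · proj₁ swap

  τ-fibre : ∀ x → ℘ (τ x) ≡ ℘ x
  τ-fibre = proj₂ swap

  τ-adj : ∀ {x y} → x X̃.∼ y → τ x X̃.∼ τ y
  τ-adj = Equivalence.to (adjacency (proj₁ swap))

  ττ : ∀ x → τ (τ x) ≡ x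
  ττ = Iso.injective {swap CTG.∙ swap} {CTG.ε}
    (trans (Hom.homo swap swap) (trans (cong₂ _+ℙ_ sgn-swap sgn-swap) (sym Hom.ε-homo)))

  -- By regularity on the fibre, a covering transformation with a fixed point is the identity,
  -- whereas `swap` is sent to `1ℙ`.
  τ-moves : ∀ x → τ x ≢ x
  τ-moves x e with fibreRegular (℘ x) {x} {x} refl refl
  ... | _ , _ , unique with trans (sym sgn-swap) (trans (Hom.⟦⟧-cong {swap} {CTG.ε} swap≈ε) Hom.ε-homo)
    where
    swap≈ε : ∀ y → τ y ≡ y
    swap≈ε y = trans (sym (unique {proj₁ swap} (proj₂ swap , e) y))
                     (unique {Aut-X̃.ε} ((λ _ → refl) , refl) y)
  ... | ()

  -- Some covering transformation takes `x` to `y`, and there are only two of them: the identity and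
  -- `τ`.
  fibre : ∀ {x y} → ℘ y ≡ ℘ x → y ≢ x → y ≡ τ x
  fibre {x} {y} e y≢x with fibreRegular (℘ x) {x} {y} refl e
  ... | c , (c∈ , xc≡y) , _ with sgn (c , c∈) in eq
  ... | 0ℙ = contradiction
        (trans (sym xc≡y) (Iso.injective {c , c∈} {CTG.ε} (trans eq (sym Hom.ε-homo)) x)) y≢x
  ... | 1ℙ = trans (sym xc≡y) (Iso.injective {c , c∈} {swap} (trans eq (sym sgn-swap)) x)

  private
    C = proj₂ split
    module C = IsComplement C

  K : Group 0ℓ 0ℓ
  K = Subgroup.group (proj₁ split)

  open Group K public using (_∙_; ε; _⁻¹)

  infixl 6 _◂_ _⊲_
  _◂_ : V X̃ → Group.Carrier K → V X̃
  x ◂ k = x · proj₁ k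

  proj : Group.Carrier K → Automorphism X
  proj k = proj₁ (C.K⊆H (proj₂ k))

  proj∈G : ∀ k → Member G (proj k)
  proj∈G k = proj₁ (proj₂ (C.K⊆H (proj₂ k)))

  _⊲_ : V X → Group.Carrier K → V X
  v ⊲ k = v · proj k

  ℘-equivariant : ∀ x k → ℘ (x ◂ k) ≡ ℘ x ⊲ k
  ℘-equivariant x k = sym (proj₂ (proj₂ (C.K⊆H (proj₂ k))) x)

  ◂-adj : ∀ k {x y} → x X̃.∼ y → x ◂ k X̃.∼ y ◂ k
  ◂-adj k = Equivalence.to (adjacency (proj₁ k))

  ◂-inv : ∀ k x → x ◂ k ◂ k ⁻¹ ≡ x
  ◂-inv k = Group.inverseʳ K k

  ◂-inj : ∀ k {x y} → x ◂ k ≡ y ◂ k → x ≡ y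
  ◂-inj k e = trans (sym (◂-inv k _)) (trans (cong (_◂ k ⁻¹) e) (◂-inv k _))

  -- As `℘` is surjective, `k` determines its projection pointwise. Hence the projections, though
  -- only chosen as witnesses, compose like the elements of `K`.
  ⊲-of : ∀ {v} {k} {y} → section v ◂ k ≡ y → v ⊲ k ≡ ℘ y
  ⊲-of {v} {k} e = trans (cong (_⊲ k) (sym (℘-section v))) (trans (sym (℘-equivariant _ k)) (cong ℘ e))

  ⊲-∙ : ∀ v k l → v ⊲ (k ∙ l) ≡ v ⊲ k ⊲ l
  ⊲-∙ v k l = trans (⊲-of {v} {k ∙ l} refl)
    (trans (℘-equivariant _ l) (cong (_⊲ l) (sym (⊲-of {v} {k} refl))))

  ⊲-ε : ∀ v → v ⊲ ε ≡ v
  ⊲-ε v = trans (⊲-of {v} {ε} refl) (℘-section v)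

  ⊲-inv : ∀ v k → v ⊲ k ⊲ k ⁻¹ ≡ v
  ⊲-inv v k = trans (sym (⊲-∙ v k (k ⁻¹)))
    (trans (⊲-of {v} {k ∙ k ⁻¹} (◂-inv k _)) (℘-section v))

  ⊲-adj : ∀ k {u v} → u ∼ v → u ⊲ k ∼ v ⊲ k
  ⊲-adj k = Equivalence.to (adjacency (proj k))

  ⊲-inj : ∀ k {u v} → u ⊲ k ≡ v ⊲ k → u ≡ v
  ⊲-inj k e = trans (sym (⊲-inv _ k)) (trans (cong (_⊲ k ⁻¹) e) (⊲-inv _ k))

  -- The factor in `K` of a lift of `g` differs from that lift by a covering transformation, so it
  -- projects to `g` as well.
  lift∈K : ∀ g → Member G g → ∃ λ k → ∀ v → v ⊲ k ≡ v · g
  lift∈K g g∈ with lifts g g∈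
  ... | g̃ , g̃-lifts with C.factor {g̃} (g , g∈ , g̃-lifts)
  ... | n , k , n∈CT , k∈K , g̃≈nk = (k , k∈K) , λ v →
    let x  = section v
        y  = x · (n Aut-X̃.⁻¹)
        yn = Aut-X̃.inverseˡ n x
        ℘y = trans (sym (n∈CT y)) (trans (cong ℘ yn) (℘-section v))
    in trans (⊲-of {v} {k , k∈K} (sym (trans (g̃≈nk y) (cong (_· k) yn))))
         (trans (sym (g̃-lifts y)) (cong (_· g) ℘y))

  -- The quotient `k ∙ l ⁻¹` projects to the identity, so it lies both in `CT` and in its
  -- complement.
  faithful : ∀ k l → (∀ v → v ⊲ k ≡ v ⊲ l) → ∀ x → x ◂ k ≡ x ◂ l
  faithful k l agree x = trans (sym (Group.inverseˡ K l (x ◂ k)))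
    (cong (_◂ l) (C.trivial {x = proj₁ (k ∙ l ⁻¹)} kl⁻¹∈CT (proj₂ (k ∙ l ⁻¹)) x))
    where
    kl⁻¹∈CT : ∀ y → ℘ (y ◂ (k ∙ l ⁻¹)) ≡ ℘ y
    kl⁻¹∈CT y = trans (℘-equivariant y (k ∙ l ⁻¹)) (trans (⊲-∙ _ k (l ⁻¹))
      (trans (cong (_⊲ l ⁻¹) (agree _)) (⊲-inv _ l)))

  square-fixes : ∀ k x → ℘ x ⊲ k ≡ ℘ x → x ◂ k ◂ k ≡ x
  square-fixes k x vk with x ◂ k ≟̃ x | x ◂ k ◂ k ≟̃ x
  ... | _      | yes e = e
  ... | yes e  | _     = trans (cong (_◂ k) e) e
  -- Both images would be the other point `τ x` of the fibre, against injectivity of `k`.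
  ... | no xk≢ | no xkk≢ = contradiction
        (◂-inj k (trans (fibre xkk-fibre xkk≢) (sym (fibre xk-fibre xk≢)))) xk≢
    where
    xk-fibre : ℘ (x ◂ k) ≡ ℘ x
    xk-fibre = trans (℘-equivariant x k) vk
    xkk-fibre : ℘ (x ◂ k ◂ k) ≡ ℘ x
    xkk-fibre = trans (℘-equivariant (x ◂ k) k) (trans (cong (_⊲ k) xk-fibre) vk)

  neighbour : ∀ v → ∃ (v ∼_)
  neighbour v = N.at v zero , N.holds v zero

  embedding : ∀ k → Embedding (_⊲ k)
  embedding k = record { adj = ⊲-adj k ; inj = ⊲-inj k }

  -- Isolated as a hypothesis because its proof depends on `s`, while the step from it to 3-cycles
  -- does not.
  KernelFixesFibre : Set
  KernelFixesFibre = ∀ k x → ℘ x ⊲ k ≡ ℘ x → (∀ {w} → ℘ x ∼ w → w ⊲ k ≡ w) → x ◂ k ≡ x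

  even-fixes : KernelFixesFibre → ∀ k x → ℘ x ⊲ k ≡ ℘ x →
               FixesAllOrNone (℘ x ∼_) (_⊲ k) → x ◂ k ≡ x
  even-fixes kernel k x vk (inj₁ all)  = kernel k x vk all
  even-fixes kernel k x vk (inj₂ none) =
    -- The square of `k` fixes `x`, so `k` and its cube, which fixes all neighbours, send `x` to the
    -- same point.
    trans (cong (_◂ k) (sym (square-fixes k x vk))) (kernel (k ∙ k ∙ k) x vkkk cube)
    where
    vkkk : ℘ x ⊲ k ∙ k ∙ k ≡ ℘ x
    vkkk = trans (⊲-∙ _ (k ∙ k) k) (trans (cong (_⊲ k) (trans (⊲-∙ _ k k)
             (trans (cong (_⊲ k) vk) vk))) vk)
    cube : ∀ {w} → ℘ x ∼ w → w ⊲ k ∙ k ∙ k ≡ w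
    cube {w} v∼w = trans (⊲-∙ w (k ∙ k) k) (trans (cong (_⊲ k) (⊲-∙ w k k))
      (free-cube (embedding k) vk none v∼w))

  -- From an orbit meeting each fibre once to the canonical double cover.

  module _
    (arc-transitive : ∀ {u v u′ v′} → u ∼ v → u′ ∼ v′ → ∃ λ k → u ⊲ k ≡ u′ × v ⊲ k ≡ v′)
    (fixes-fibre : ∀ k x → ℘ x ⊲ k ≡ ℘ x → x ◂ k ≡ x)
    where

    private
      x₀ = proj₁ X̃-connected

      carry : ∀ v → ∃ λ k → ℘ x₀ ⊲ k ≡ v
      carry v with arc-transitive (proj₂ (neighbour (℘ x₀))) (proj₂ (neighbour v))
      ... | k , e , _ = k , e

    orbit-meets-fibre-once : ∀ k l x → ℘ x ⊲ k ≡ ℘ x ⊲ l → x ◂ k ≡ x ◂ l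
    orbit-meets-fibre-once k l x e = trans (sym (Group.inverseˡ K l (x ◂ k))) (cong (_◂ l)
      (fixes-fibre (k ∙ l ⁻¹) x
        (trans (⊲-∙ _ k (l ⁻¹)) (trans (cong (_⊲ l ⁻¹) e) (⊲-inv _ l)))))

    -- This is the `K`-orbit of `x₀`, viewed as a section of `℘`; by `orbit-meets-fibre-once` the
    -- choices in `carry` do not affect it.
    σ : V X → V X̃
    σ v = x₀ ◂ proj₁ (carry v)

    ℘σ : ∀ v → ℘ (σ v) ≡ v
    ℘σ v = trans (℘-equivariant x₀ _) (proj₂ (carry v))

    σ-equivariant : ∀ {u v} k → u ⊲ k ≡ v → σ u ◂ k ≡ σ v
    σ-equivariant {u} {v} k e = orbit-meets-fibre-once (proj₁ (carry u) ∙ k) (proj₁ (carry v)) x₀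
      (trans (⊲-∙ _ _ k) (trans (cong (_⊲ k) (proj₂ (carry u))) (trans e (sym (proj₂ (carry v))))))

    σ-base : σ (℘ x₀) ≡ x₀
    σ-base = orbit-meets-fibre-once (proj₁ (carry (℘ x₀))) ε x₀
      (trans (proj₂ (carry (℘ x₀))) (sym (⊲-ε _)))

    -- Otherwise, by arc-transitivity, the image of σ would be a union of components.
    σ-independent : ∀ {u v} → u ∼ v → ¬ (σ u X̃.∼ σ v)
    σ-independent {u} {v} u∼v σu∼σv = τ-moves x₀
      (trans (walk (proj₂ X̃-connected x₀ (τ x₀)) (sym σ-base)) (trans (cong σ (τ-fibre x₀)) σ-base))
      where
      everywhere : ∀ {u′ v′} → u′ ∼ v′ → σ u′ X̃.∼ σ v′
      everywhere u′∼v′ with arc-transitive u∼v u′∼v′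
      ... | k , uk , vk = subst₂ X̃._∼_ (σ-equivariant k uk) (σ-equivariant k vk) (◂-adj k σu∼σv)

      walk : ∀ {x y} → Star X̃._∼_ x y → x ≡ σ (℘ x) → y ≡ σ (℘ y)
      walk ε⋆ e = e
      walk {x} (_◅_ {j = z} x∼z z⋆y) e = walk z⋆y
        (lift-unique x∼z (subst (X̃._∼ σ (℘ z)) (sym e) (everywhere (homomorphism x∼z)))
          (sym (℘σ (℘ z))))

    -- The edge over `u ∼ v` that starts at `σ u` ends at one of the two points over `v`, and `σ v`
    -- is excluded.
    σ∼τσ : ∀ {u v} → u ∼ v → σ u X̃.∼ τ (σ v)
    σ∼τσ {u} {v} u∼v with locallyBijective (σ u) (subst (_∼ v) (sym (℘σ u)) u∼v)
    ... | y , (σu∼y , ℘y) , _ = subst (σ u X̃.∼_)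
      (fibre (trans ℘y (sym (℘σ v))) (λ y≡σv → σ-independent u∼v (subst (σ u X̃.∼_) y≡σv σu∼y))) σu∼y

    point : V X → Parity → V X̃
    point v 0ℙ = σ v
    point v 1ℙ = τ (σ v)

    ℘-point : ∀ v i → ℘ (point v i) ≡ v
    ℘-point v 0ℙ = ℘σ v
    ℘-point v 1ℙ = trans (τ-fibre (σ v)) (℘σ v)

    point-adj : ∀ {u v} i → u ∼ v → point u i X̃.∼ point v (i +ℙ 1ℙ)
    point-adj 0ℙ u∼v = σ∼τσ u∼v
    point-adj 1ℙ u∼v = subst (τ (σ _) X̃.∼_) (ττ _) (τ-adj (σ∼τσ u∼v))

    colour : V X̃ → Parity
    colour x with x ≟̃ σ (℘ x)
    ... | yes _ = 0ℙ
    ... | no  _ = 1ℙ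

    point-colour : ∀ x → point (℘ x) (colour x) ≡ x
    point-colour x with x ≟̃ σ (℘ x)
    ... | yes e = sym e
    ... | no ≢σ = sym (fibre (sym (℘σ (℘ x))) ≢σ)

    colour-point : ∀ v i → colour (point v i) ≡ i
    colour-point v 0ℙ with σ v ≟̃ σ (℘ (σ v))
    ... | yes _ = refl
    ... | no ≢σ = contradiction (cong σ (sym (℘σ v))) ≢σ
    colour-point v 1ℙ with τ (σ v) ≟̃ σ (℘ (τ (σ v)))
    ... | yes e = contradiction (trans e (cong σ (℘-point v 1ℙ))) (τ-moves (σ v))
    ... | no  _ = refl

    coveringIso : CoveringIso {X} {X̃} {CDC X} ℘ (CDC-projection X)
    coveringIso = record
      { bijection = mk↔ₛ′ (λ x → ℘ x , colour x) (λ (v , i) → point v i)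
          (λ (v , i) → cong₂ _,_ (℘-point v i) (colour-point v i)) point-colour
      ; adjacency = λ {x} {y} → mk⇔
          (λ x∼y → homomorphism x∼y , colour-flips x∼y)
          (λ (u∼v , e) → subst₂ X̃._∼_ (point-colour x)
            (trans (cong (point (℘ y)) (sym e)) (point-colour y)) (point-adj (colour x) u∼v))
      } , λ _ → refl
      where
      colour-flips : ∀ {x y} → x X̃.∼ y → colour y ≡ colour x +ℙ 1ℙ
      colour-flips {x} {y} x∼y = trans (cong colour y≡) (colour-point (℘ y) _)
        where
        -- Both sides are neighbours of `x` over the same vertex.
        y≡ : y ≡ point (℘ y) (colour x +ℙ 1ℙ)
        y≡ = lift-unique x∼y
          (subst (X̃._∼ point (℘ y) (colour x +ℙ 1ℙ)) (point-colour x)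
            (point-adj (colour x) (homomorphism x∼y)))
          (sym (℘-point (℘ y) (colour x +ℙ 1ℙ)))

  -- Transfer of arc-regularity from `G` to the complement.

  module _ {s} (regular : ArcRegular {X} s G) where

    transitive : ∀ {a b} → IsArc X s a → IsArc X s b → ∃ λ k → mapⱽ (_⊲ k) a ≡ b
    transitive a-arc b-arc with regular a-arc b-arc
    ... | g , (g∈ , ag≡b) , _ with lift∈K g g∈
    ... | k , k≗g = k , trans (map-cong k≗g _) ag≡b

    -- Regularity compares two given arcs, so `free` must know that the common image is an arc too.
    image-arc : ∀ {a} k → IsArc X s a → IsArc X s (mapⱽ (_⊲ k) a)
    image-arc {a} k a-arc = record
      { adjacent = λ i j e → subst₂ _∼_ (sym (lookup-map i (_⊲ k) a)) (sym (lookup-map j (_⊲ k) a))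
          (⊲-adj k (IsArc.adjacent a-arc i j e))
      ; nonbacktracking = λ i j e eq → IsArc.nonbacktracking a-arc i j e
          (⊲-inj k (trans (sym (lookup-map i (_⊲ k) a)) (trans eq (lookup-map j (_⊲ k) a))))
      }

    -- Uniqueness in `regular` makes the projections of `k` and `l` agree, and `faithful` lifts this
    -- to the cover.
    free : ∀ {a} → IsArc X s a → ∀ k l → mapⱽ (_⊲ k) a ≡ mapⱽ (_⊲ l) a → ∀ x → x ◂ k ≡ x ◂ l
    free a-arc k l agree = faithful k l λ v →
      trans (sym (unique {proj k} (proj∈G k , agree) v)) (unique {proj l} (proj∈G l , refl) v)
      where unique = proj₂ (proj₂ (regular a-arc (image-arc l a-arc)))

  -- The case s = 1.

  module OneRegular (regular : ArcRegular {X} 1 G) where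

    arc-transitive : ∀ {u v u′ v′} → u ∼ v → u′ ∼ v′ → ∃ λ k → u ⊲ k ≡ u′ × v ⊲ k ≡ v′
    arc-transitive u∼v u′∼v′ with transitive regular (arc₁ u∼v) (arc₁ u′∼v′)
    ... | k , refl = k , refl , refl

    arc-stabilizer-trivial : ∀ k x {w} → ℘ x ∼ w → ℘ x ⊲ k ≡ ℘ x → w ⊲ k ≡ w → x ◂ k ≡ x
    arc-stabilizer-trivial k x v∼w vk wk = free regular (arc₁ v∼w) k ε
      (cong₂ (λ a b → a ∷ b ∷ []) (trans vk (sym (⊲-ε _))) (trans wk (sym (⊲-ε _)))) x

    kernel : KernelFixesFibre
    kernel k x vk all = arc-stabilizer-trivial k x (proj₂ (neighbour _)) vk (all (proj₂ (neighbour _)))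

    -- If `k` fixes some neighbour it fixes a 1-arc and is trivial; otherwise it is a 3-cycle on the
    -- neighbours.
    fixes-fibre : ∀ k x → ℘ x ⊲ k ≡ ℘ x → x ◂ k ≡ x
    fixes-fibre k x vk with any? (λ i → N.at (℘ x) i ⊲ k ≟ N.at (℘ x) i)
    ... | yes (i , e) = arc-stabilizer-trivial k x (N.holds (℘ x) i) vk e
    ... | no  none    = even-fixes kernel k x vk (inj₂ λ v∼w e →
          none (N.index (℘ x) v∼w , subst (λ z → z ⊲ k ≡ z) (sym (N.at-index (℘ x) v∼w)) e))

    isCanonical : CoveringIso {X} {X̃} {CDC X} ℘ (CDC-projection X)
    isCanonical = coveringIso arc-transitive fixes-fibre

  -- The case s = 4.

  module FourRegular (regular : ArcRegular {X} 4 G) where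

    vec₅ : ∀ {a b c d e a′ b′ c′ d′ e′ : V X} → a ≡ a′ → b ≡ b′ → c ≡ c′ → d ≡ d′ → e ≡ e′ →
           _≡_ {A = Vec (V X) 5} (a ∷ b ∷ c ∷ d ∷ e ∷ []) (a′ ∷ b′ ∷ c′ ∷ d′ ∷ e′ ∷ [])
    vec₅ refl refl refl refl refl = refl

    arc-transitive : ∀ {u v u′ v′} → u ∼ v → u′ ∼ v′ → ∃ λ k → u ⊲ k ≡ u′ × v ⊲ k ≡ v′
    arc-transitive u∼v u′∼v′ =
      let _ , _ , _ , arc  = longArc u∼v
          _ , _ , _ , arc′ = longArc u′∼v′
          k , e = transitive regular arc arc′
      in k , ∷-injectiveˡ e , ∷-injectiveˡ (∷-injectiveʳ e)

    module _ (k : Group.Carrier K) (x : V X̃) (vk : ℘ x ⊲ k ≡ ℘ x)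
      {b c} (v∼b : ℘ x ∼ b) (v∼c : ℘ x ∼ c) (b≢c : b ≢ c) (bk : b ⊲ k ≡ b) (ck : c ⊲ k ≡ c)
      (B : OtherNeighbours b (℘ x)) (C : OtherNeighbours c (℘ x))
      where

      both-fixed : q B ⊲ k ≡ q B → q C ⊲ k ≡ q C → x ◂ k ≡ x
      both-fixed b′k c′k = free regular (centredArc v∼b v∼c b≢c B C) k ε
        (vec₅ (asε b′k) (asε bk) (asε vk) (asε ck) (asε c′k)) x
        where
        asε : ∀ {w} → w ⊲ k ≡ w → w ⊲ k ≡ w ⊲ ε
        asε e = trans e (sym (⊲-ε _))

      -- Here k is the square of the element h with (b′,b,v,c,c′) h = (c′,c,v,b,b″).
      both-moved : q B ⊲ k ≢ q B → q C ⊲ k ≢ q C → x ◂ k ≡ x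
      both-moved b′k c′k
        with transitive regular (centredArc v∼b v∼c b≢c B C) (centredArc v∼c v∼b (≢-sym b≢c) C (flip B))
      ... | h , eq = trans
          (free regular (centredArc v∼b v∼c b≢c B C) k (h ∙ h)
            (vec₅ (asSquare (q-moves (embedding k) B bk vk b′k) (trans (cong (_⊲ h) b′h) c′h))
                  (asSquare bk (trans (cong (_⊲ h) bh) ch))
                  (asSquare vk (trans (cong (_⊲ h) vh) vh))
                  (asSquare ck (trans (cong (_⊲ h) ch) bh))
                  (asSquare (q-moves (embedding k) C ck vk c′k)
                    -- As `h` takes `b` to `c`, fixes `v` and takes `q B` to `q C`, it takes `r B`
                    -- to `r C`.
                    (trans (cong (_⊲ h) c′h) (r-image (embedding h) B C bh vh b′h))))
            x)
          (square-fixes h x vh)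
        where
        eq₁ = ∷-injectiveʳ eq
        eq₂ = ∷-injectiveʳ eq₁
        eq₃ = ∷-injectiveʳ eq₂
        b′h : q B ⊲ h ≡ q C
        b′h = ∷-injectiveˡ eq
        bh : b ⊲ h ≡ c
        bh = ∷-injectiveˡ eq₁
        vh : ℘ x ⊲ h ≡ ℘ x
        vh = ∷-injectiveˡ eq₂
        ch : c ⊲ h ≡ b
        ch = ∷-injectiveˡ eq₃
        c′h : q C ⊲ h ≡ r B
        c′h = ∷-injectiveˡ (∷-injectiveʳ eq₃)
        asSquare : ∀ {w z} → w ⊲ k ≡ z → w ⊲ h ⊲ h ≡ z → w ⊲ k ≡ w ⊲ h ∙ h
        asSquare e e′ = trans e (sym (trans (⊲-∙ _ h h) e′))

    -- At each of the three neighbours `k` either fixes or interchanges the two further vertices;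
    -- two of the neighbours fall under the same alternative.
    kernel : KernelFixesFibre
    kernel k x vk all = byPigeonhole (moves? zero) (moves? (suc zero)) (moves? (suc (suc zero)))
      where
      n : Fin 3 → V X
      n = N.at (℘ x)
      v∼n = N.holds (℘ x)
      O : ∀ i → OtherNeighbours (n i) (℘ x)
      O i = others (∼-sym (v∼n i))
      moves? : ∀ i → Dec (q (O i) ⊲ k ≡ q (O i))
      moves? i = q (O i) ⊲ k ≟ q (O i)
      fixed : ∀ i j → i ≢ j → q (O i) ⊲ k ≡ q (O i) → q (O j) ⊲ k ≡ q (O j) → x ◂ k ≡ x
      fixed i j i≢j = both-fixed k x vk (v∼n i) (v∼n j) (i≢j ∘ N.distinct _ i j)
        (all (v∼n i)) (all (v∼n j)) (O i) (O j)
      moved : ∀ i j → i ≢ j → q (O i) ⊲ k ≢ q (O i) → q (O j) ⊲ k ≢ q (O j) → x ◂ k ≡ x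
      moved i j i≢j = both-moved k x vk (v∼n i) (v∼n j) (i≢j ∘ N.distinct _ i j)
        (all (v∼n i)) (all (v∼n j)) (O i) (O j)
      byPigeonhole : Dec _ → Dec _ → Dec _ → x ◂ k ≡ x
      byPigeonhole (yes e₀) (yes e₁) _        = fixed zero (suc zero) (λ ()) e₀ e₁
      byPigeonhole (yes e₀) _        (yes e₂) = fixed zero (suc (suc zero)) (λ ()) e₀ e₂
      byPigeonhole _        (yes e₁) (yes e₂) = fixed (suc zero) (suc (suc zero)) (λ ()) e₁ e₂
      byPigeonhole (no m₀)  (no m₁)  _        = moved zero (suc zero) (λ ()) m₀ m₁
      byPigeonhole (no m₀)  _        (no m₂)  = moved zero (suc (suc zero)) (λ ()) m₀ m₂
      byPigeonhole _        (no m₁)  (no m₂)  = moved (suc zero) (suc (suc zero)) (λ ()) m₁ m₂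

    -- Of k, l and kl one is an even permutation of the neighbours; since k and kl
    -- move x, it is l.
    stabilizer-locally-even : ∀ k l x → ℘ x ⊲ k ≡ ℘ x → x ◂ k ≢ x → x ◂ l ≡ x →
      ∀ {w} → ℘ x ∼ w → w ⊲ l ≡ w → ∀ {z} → ℘ x ∼ z → z ⊲ l ≡ z
    stabilizer-locally-even k l x vk xk≢x xl v∼w wl =
      conclude (one-locally-even (embedding k) (embedding l) vk vl)
      where
      vl : ℘ x ⊲ l ≡ ℘ x
      vl = trans (sym (℘-equivariant x l)) (cong ℘ xl)
      vkl : ℘ x ⊲ k ∙ l ≡ ℘ x
      vkl = trans (⊲-∙ _ k l) (trans (cong (_⊲ l) vk) vl)
      composite : FixesAllOrNone (℘ x ∼_) (λ w → w ⊲ k ⊲ l) → FixesAllOrNone (℘ x ∼_) (_⊲ k ∙ l)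
      composite = map-⊎ (λ e p → trans (⊲-∙ _ k l) (e p)) (λ e p → e p ∘ trans (sym (⊲-∙ _ k l)))
      conclude : FixesAllOrNone (℘ x ∼_) (_⊲ k) ⊎ FixesAllOrNone (℘ x ∼_) (_⊲ l) ⊎
                 FixesAllOrNone (℘ x ∼_) (λ w → w ⊲ k ⊲ l) → ∀ {z} → ℘ x ∼ z → z ⊲ l ≡ z
      conclude (inj₁ k-even)             = contradiction (even-fixes kernel k x vk k-even) xk≢x
      conclude (inj₂ (inj₁ (inj₁ all)))  = all
      conclude (inj₂ (inj₁ (inj₂ none))) = contradiction wl (none v∼w)
      conclude (inj₂ (inj₂ kl-even))     = contradiction
        (◂-inj l (trans (even-fixes kernel (k ∙ l) x vkl (composite kl-even)) (sym xl))) xk≢x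

    -- Such a `k` interchanges the two points of the fibre; the aim is to show that none exists.
    Moves : Group.Carrier K → V X̃ → Set
    Moves k x = ℘ x ⊲ k ≡ ℘ x × x ◂ k ≢ x

    moves-conjugate : ∀ {k x} → Moves k x → ∀ m y → ℘ y ⊲ m ≡ ℘ x → Moves (m ∙ k ∙ m ⁻¹) y
    moves-conjugate {k} {x} (vk , xk≢x) m y ym = fibre-fixed , λ e → moves (back e) (y ◂ m ≟̃ x)
      where
      fibre-fixed : ℘ y ⊲ m ∙ k ∙ m ⁻¹ ≡ ℘ y
      fibre-fixed = trans (⊲-∙ (℘ y) (m ∙ k) (m ⁻¹)) (trans (cong (_⊲ m ⁻¹)
        (trans (⊲-∙ (℘ y) m k) (trans (cong (_⊲ k) ym) (trans vk (sym ym))))) (⊲-inv (℘ y) m))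
      ℘ym : ℘ (y ◂ m) ≡ ℘ x
      ℘ym = trans (℘-equivariant y m) ym
      back : y ◂ m ◂ k ◂ m ⁻¹ ≡ y → y ◂ m ◂ k ≡ y ◂ m
      back e = trans (sym (Group.inverseˡ K m (y ◂ m ◂ k))) (cong (_◂ m) e)
      moves : y ◂ m ◂ k ≡ y ◂ m → ¬ Dec (y ◂ m ≡ x)
      moves e (yes ym≡x) = xk≢x (subst (λ z → z ◂ k ≡ z) ym≡x e)
      -- Here `y ◂ m` is `τ x`. If `k` fixed it, `k` would send both points of the fibre to `τ x`.
      moves e (no  ym≢x) = ym≢x (◂-inj k (trans e (trans (fibre ℘ym ym≢x)
        (sym (fibre (trans (℘-equivariant x k) vk) xk≢x)))))

    moves-everywhere : ∀ {k x} → Moves k x → ∀ y → ∃ λ h → Moves h y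
    moves-everywhere {x = x} moved y =
      let m , ym , _ = arc-transitive (proj₂ (neighbour (℘ y))) (proj₂ (neighbour (℘ x)))
      in _ , moves-conjugate moved m y ym

    -- Since `t` fixes `y`, fixing the neighbours of `℘ y` amounts to fixing those of `y`; the form
    -- downstairs suits `stabilizer-locally-even`.
    FixesStar : Group.Carrier K → V X̃ → Set
    FixesStar t y = y ◂ t ≡ y × (∀ {w} → ℘ y ∼ w → w ⊲ t ≡ w)

    -- Along an edge from `y` to `u`, `t` fixes `u` and the neighbour `℘ y` of `℘ u`. A conjugate of
    -- `k` moves `u`, so `t` is even around `℘ u` and fixes all neighbours there.
    fixesStar-spreads : ∀ {k x} → Moves k x → ∀ t {y z} → Star X̃._∼_ y z →
                        FixesStar t y → FixesStar t z
    fixesStar-spreads moved t ε⋆ fixes = fixes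
    fixesStar-spreads moved t {y} (_◅_ {j = u} y∼u u⋆z) (yt , nbrs) =
      fixesStar-spreads moved t u⋆z (ut , nbrs-u)
      where
      ut : u ◂ t ≡ u
      ut = lift-unique (subst (X̃._∼ u ◂ t) yt (◂-adj t y∼u)) y∼u
        (trans (℘-equivariant u t) (nbrs (homomorphism y∼u)))
      nbrs-u : ∀ {w} → ℘ u ∼ w → w ⊲ t ≡ w
      nbrs-u = let h , uh , h-moves = moves-everywhere moved u in
        stabilizer-locally-even h t u uh h-moves ut
          (∼-sym (homomorphism y∼u)) (trans (sym (℘-equivariant y t)) (cong ℘ yt))

    -- Take `t` carrying a 4-arc centred at `v` to the one differing only in its first vertex: it
    -- fixes `v` and two of its neighbours, hence the third.
    nontrivial-kernel : ∀ v → ∃ λ t → v ⊲ t ≡ v × (∀ {w} → v ∼ w → w ⊲ t ≡ w) × ∃ λ w → w ⊲ t ≢ w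
    nontrivial-kernel v = construct (proj₂ (neighbour v)) (others (proj₂ (neighbour v)))
      where
      construct : ∀ {c} → v ∼ c → OtherNeighbours v c →
                  ∃ λ t → v ⊲ t ≡ v × (∀ {w} → v ∼ w → w ⊲ t ≡ w) × ∃ λ w → w ⊲ t ≢ w
      construct {c} v∼c A = twist (others (∼-sym (u∼q A))) (others (∼-sym v∼c))
        where
        twist : OtherNeighbours (q A) v → OtherNeighbours c v →
                ∃ λ t → v ⊲ t ≡ v × (∀ {w} → v ∼ w → w ⊲ t ≡ w) × ∃ λ w → w ⊲ t ≢ w
        twist B C with transitive regular (centredArc (u∼q A) v∼c (≢-sym (p≢q A)) B C)
                                  (centredArc (u∼q A) v∼c (≢-sym (p≢q A)) (flip B) C)
        ... | t , eq = t , vt , nbrs , q B , λ e → q≢r B (trans (sym e) (∷-injectiveˡ eq))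
          where
          eq₁ = ∷-injectiveʳ eq
          eq₂ = ∷-injectiveʳ eq₁
          bt : q A ⊲ t ≡ q A
          bt = ∷-injectiveˡ eq₁
          vt : v ⊲ t ≡ v
          vt = ∷-injectiveˡ eq₂
          ct : c ⊲ t ≡ c
          ct = ∷-injectiveˡ (∷-injectiveʳ eq₂)
          nbrs : ∀ {w} → v ∼ w → w ⊲ t ≡ w
          nbrs {w} v∼w with w ≟ c | w ≟ q A
          ... | yes refl | _        = ct
          ... | _        | yes refl = bt
          ... | no w≢c   | no w≢b   = subst (λ z → z ⊲ t ≡ z) (sym (rest A v∼w w≢c w≢b))
                (r-image (embedding t) A A vt ct bt)

    -- If `k` moved `x`, the element from `nontrivial-kernel` would fix every point of the connected
    -- cover, and so every vertex of `X`.
    fixes-fibre : ∀ k x → ℘ x ⊲ k ≡ ℘ x → x ◂ k ≡ x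
    fixes-fibre k x vk = decidable-stable (x ◂ k ≟̃ x) λ xk≢x →
      let t , vt , nbrs , w , wt≢w = nontrivial-kernel (℘ x)
          wt = proj₁ (fixesStar-spreads (vk , xk≢x) t (proj₂ X̃-connected x (section w))
                       (kernel t x vt nbrs , nbrs))
      in wt≢w (trans (⊲-of {w} {t} wt) (℘-section w))

    isCanonical : CoveringIso {X} {X̃} {CDC X} ℘ (CDC-projection X)
    isCanonical = coveringIso arc-transitive fixes-fibre

theorem4p1 : (X : Graph) → Connected X → Cubic X →
    (s : ℕ) → s ≡ 1 ⊎ s ≡ 4 →
    (G : Subgroup (Aut X) 0ℓ) → ArcRegular {X} s G →
    (X̃ : Graph) → Connected X̃ →
    (℘ : V X̃ → V X) → IsSplit2Cover {X̃} {X} ℘ G →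
    CoveringIso {X} {X̃} {CDC X} ℘ (CDC-projection X)
theorem4p1 X _ cubic _ (inj₁ refl) G regular X̃ X̃-connected ℘ cover =
  SplitCover.OneRegular.isCanonical cubic X̃-connected cover regular
theorem4p1 X _ cubic _ (inj₂ refl) G regular X̃ X̃-connected ℘ cover =
  SplitCover.FourRegular.isCanonical cubic X̃-connected cover regular
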